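{- Let $\alpha \leq \kappa(\mathfrak{Small})$ be a regular cardinal that is also a strong limit cardinal, and let $\mathfrak{J}_\alpha$ be a set of $\alpha$-small sets containing all $\alpha$-small cardinals. Let $(\Sigma,A)$ be a $\mathfrak{J}_\alpha$-ary algebra whose underlying set $A$ is $\alpha$-small. Then the $\mathfrak{J}_\alpha$-ary double centralizer $(\Sigma^A)^{\perp\perp}$ is the set of all $\mathfrak{J}_\alpha$-ary operations $f:A^J \rightarrow A$ such that $h(f) = f(h \circ u_J)$ for every $\Sigma$-homomorphism $h:A^{(A^J)} \rightarrow A$, where $u_J:J\to A^{(A^J)}$ is the map that sends each $j\in J$ to the projection $\pi_j:A^J\to A$.
   Context: Fix a Grothendieck universe $\mathfrak{Small}$, i.e. the set of all sets of rank less than a fixed inaccessible cardinal $\kappa = \kappa(\mathfrak{Small})$; its elements are called small sets. Let $\alpha \leq \kappa(\mathfrak{Small})$ be an (infinite) regular cardinal. It is a strong limit cardinal if $2^\beta<\alpha$ for every cardinal $\beta<\alpha$. A set is $\alpha$-small if it is small and has cardinality less than $\alpha$. Fix a set $\mathfrak{J}_\alpha$ of sets with $\mathfrak{Card}_\alpha \subseteq \mathfrak{J}_\alpha \subseteq \mathfrak{Small}_\alpha$, where $\mathfrak{Card}_\alpha$ is the set of all $\alpha$-small cardinals and $\mathfrak{Small}_\alpha$ is the set of all $\alpha$-small sets. Given a set $A$, a $\mathfrak{J}_\alpha$-ary operation on $A$ is a map $A^J \to A$ with $J \in \mathfrak{J}_\alpha$ (its arity); nullary operations are allowed. A $\mathfrak{J}_\alpha$-ary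 signature is a (possibly large) set $\Sigma$ with an assignment of an arity in $\mathfrak{J}_\alpha$ to each $\sigma\in\Sigma$. A $\Sigma$-algebra is a set $A$ equipped with an operation $\sigma^A:A^J\to A$ for each $\sigma\in\Sigma$, where $J$ is the arity of $\sigma$; a $\Sigma$-homomorphism is a map preserving these basic operations. A $\mathfrak{J}_\alpha$-ary algebra is a pair $(\Sigma,A)$ of a $\mathfrak{J}_\alpha$-ary signature $\Sigma$ and a $\Sigma$-algebra $A$; write $\Sigma^A=\{\sigma^A\mid\sigma\in\Sigma\}$. Each power $A^Y$ is a $\Sigma$-algebra under the pointwise operations; in particular $A^{(A^J)}$ is a $\Sigma$-algebra. Operations $f:A^X\to A$ and $g:A^Y\to A$ commute, written $f\perp g$, if for every matrix $a=(a_{xy})\in A^{X\times Y}$ one has $g\bigl((f((a_{xy})_{x\in X}))_{y\in Y}\bigr)=f\bigl((g((a_{xy})_{y\in Y}))_{x\in X}\bigr)$. For a set $G$ of $\mathfrak{J}_\alpha$-ary operations on $A$, $G^\perp$ is the set of all $\mathfrak{J}_\alpha$-ary operations $f$ on $A$ with $f\perp g$ for all $g\in G$, and $G^{\perp\perp}=(G^\perp)^\perp$ is its $\mathfrak{J}_\alpha$-ary double centralizer. In $h(f)$, the map $f:A^J\to A$ is regarded as an element of $A^{(A^J)}$; and $h\circ u_J:J\to A$ is regarded as an element of $A^J$. -}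

module Defs where

open import Level using (Level; _⊔_; Lift; lift; lower) renaming (suc to lsuc)
open import Data.Bool.Properties using (≡-setoid)
open import Data.Empty.Polymorphic using (⊥; ⊥-elim)
open import Data.Maybe.Base using (Maybe; maybe′)
open import Data.Nat.Base using (ℕ; zero; suc)
open import Data.Product.Base using (Σ; ∃; _×_; _,_; proj₁; proj₂)
open import Data.Product.Relation.Binary.Pointwise.NonDependent using (_×ₛ_)
open import Data.Sum.Base using (_⊎_)
open import Function.Bundles using (Func; Inverse; _⟨$⟩_)
open import Function.Construct.Composition using (function)
open import Function.Relation.Binary.Setoid.Equality using (_⇨_)
open import Relation.Binary.Bundles using (Setoid)
open import Relation.Nullary.Negation using (¬_)
open import Relation.Unary using (Pred)

private
  variable
    ℓ s t : Level

------------------------------------------------------------------------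
-- Sets.  The ambient universe of sets is Aczel's type of well-founded
-- trees: sup I x is the set { x i | i : I }, and equality of sets is the
-- extensional relation _≈ᵛ_ rather than propositional equality.

data V (ℓ : Level) : Set (lsuc ℓ) where
  sup : (I : Set ℓ) → (I → V ℓ) → V ℓ

Ix : V ℓ → Set ℓ
Ix (sup I _) = I

el : (x : V ℓ) → Ix x → V ℓ
el (sup _ x) = x

infix 4 _≈ᵛ_ _∈ᵛ_ _≤ᵛ_ _≅_

_≈ᵛ_ : V ℓ → V ℓ → Set ℓ
sup I x ≈ᵛ sup J y =
  (∀ i → ∃ λ j → x i ≈ᵛ y j) × (∀ j → ∃ λ i → x i ≈ᵛ y j)

_∈ᵛ_ : V ℓ → V ℓ → Set ℓ
x ∈ᵛ y = ∃ λ j → x ≈ᵛ el y j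

≈ᵛ-refl : (x : V ℓ) → x ≈ᵛ x
≈ᵛ-refl (sup I x) = (λ i → i , ≈ᵛ-refl (x i)) , (λ i → i , ≈ᵛ-refl (x i))

≈ᵛ-sym : (x y : V ℓ) → x ≈ᵛ y → y ≈ᵛ x
≈ᵛ-sym (sup I x) (sup J y) (p , q) =
  (λ j → proj₁ (q j) , ≈ᵛ-sym (x (proj₁ (q j))) (y j) (proj₂ (q j))) ,
  (λ i → proj₁ (p i) , ≈ᵛ-sym (x i) (y (proj₁ (p i))) (proj₂ (p i)))

≈ᵛ-trans : (x y z : V ℓ) → x ≈ᵛ y → y ≈ᵛ z → x ≈ᵛ z
≈ᵛ-trans (sup I x) (sup J y) (sup K z) (p , q) (p′ , q′) =
  (λ i → let (j , e) = p i ; (k , e′) = p′ j in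
         k , ≈ᵛ-trans (x i) (y j) (z k) e e′) ,
  (λ k → let (j , e′) = q′ k ; (i , e) = q j in
         i , ≈ᵛ-trans (x i) (y j) (z k) e e′)

-- The elements of a set, as a setoid.  Maps between sets are maps of these
-- setoids (Func), and the power A^J is the setoid El J ⇨ El A.

El : V ℓ → Setoid ℓ ℓ
El x = record
  { Carrier       = Ix x
  ; _≈_           = λ i j → el x i ≈ᵛ el x j
  ; isEquivalence = record
    { refl  = λ {i} → ≈ᵛ-refl (el x i)
    ; sym   = λ {i} {j} → ≈ᵛ-sym (el x i) (el x j)
    ; trans = λ {i} {j} {k} → ≈ᵛ-trans (el x i) (el x j) (el x k)
    }
  }

_≅_ : Setoid ℓ ℓ → Setoid ℓ ℓ → Set ℓ
S ≅ T = Inverse S T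

------------------------------------------------------------------------
-- Ordinals and cardinals, in the sense of von Neumann

∅ : V ℓ
∅ = sup ⊥ ⊥-elim

-- x ∪ { x }
succ : V ℓ → V ℓ
succ x = sup (Maybe (Ix x)) (maybe′ (el x) x)

ω : V ℓ
ω {ℓ} = sup (Lift ℓ ℕ) (λ n → numeral (lower n))
  where
  numeral : ℕ → V ℓ
  numeral zero    = ∅
  numeral (suc n) = succ (numeral n)

-- The union of the sets rank y + 1 for y ∈ x.
rank : V ℓ → V ℓ
rank (sup I x) =
  sup (Σ I λ i → Ix (succ (rank (x i)))) (λ (i , k) → el (succ (rank (x i))) k)

IsTransitive : V ℓ → Set (lsuc ℓ)
IsTransitive x = ∀ y z → z ∈ᵛ y → y ∈ᵛ x → z ∈ᵛ x

-- Well-foundedness of ∈ᵛ is built into V, so a hereditarily transitive set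
-- is an ordinal.
record IsOrdinal (x : V ℓ) : Set (lsuc ℓ) where
  field
    transitive         : IsTransitive x
    elementsTransitive : ∀ y → y ∈ᵛ x → IsTransitive y

_≤ᵛ_ : V ℓ → V ℓ → Set ℓ
x ≤ᵛ y = x ∈ᵛ y ⊎ x ≈ᵛ y

record IsCardinal (x : V ℓ) : Set (lsuc ℓ) where
  field
    isOrdinal : IsOrdinal x
    initial   : ∀ y → y ∈ᵛ x → ¬ (El y ≅ El x)

-- For a cardinal α: S has a cardinality, and it is less than α.  (Under the
-- axiom of choice, which is not assumed here, every set has a cardinality.)
∣_∣<_ : Setoid ℓ ℓ → V ℓ → Set (lsuc ℓ)
∣ S ∣< α = ∃ λ β → IsCardinal β × (S ≅ El β) × β ∈ᵛ α

-- Infinite cardinals α such that no map from an ordinal β < α to α is cofinal.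
record IsRegular (α : V ℓ) : Set (lsuc ℓ) where
  field
    isCardinal : IsCardinal α
    infinite   : ω ≤ᵛ α
    bounded    : ∀ β → β ∈ᵛ α → (φ : Func (El β) (El α)) →
                 ∃ λ γ → γ ∈ᵛ α × (∀ i → el α (φ ⟨$⟩ i) ∈ᵛ γ)

IsStrongLimit : V ℓ → Set (lsuc ℓ)
IsStrongLimit α = ∀ β → IsCardinal β → β ∈ᵛ α → ∣ El β ⇨ ≡-setoid ∣< α

record IsInaccessible (κ : V ℓ) : Set (lsuc ℓ) where
  field
    uncountable   : ω ∈ᵛ κ
    isRegular     : IsRegular κ
    isStrongLimit : IsStrongLimit κ

-- Membership in the Grothendieck universe determined by κ.
IsSmall : V ℓ → V ℓ → Set ℓ
IsSmall κ x = rank x ∈ᵛ κ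

IsαSmall : (κ α : V ℓ) → V ℓ → Set (lsuc ℓ)
IsαSmall κ α x = IsSmall κ x × (∣ El x ∣< α)

------------------------------------------------------------------------
-- Algebras

record Signature (𝔍 : V ℓ) (s : Level) : Set (lsuc (ℓ ⊔ s)) where
  field
    Symbol  : Set s
    arity   : Symbol → V ℓ
    arity∈𝔍 : ∀ σ → arity σ ∈ᵛ 𝔍

module _ {𝔍 : V ℓ} (Sig : Signature 𝔍 s) where
  open Signature Sig

  Algebra : Setoid ℓ ℓ → Set (ℓ ⊔ s)
  Algebra S = (σ : Symbol) → Func (El (arity σ) ⇨ S) S

  record Hom {S T : Setoid ℓ ℓ} (𝐒 : Algebra S) (𝐓 : Algebra T) :
             Set (ℓ ⊔ s) where
    field
      map       : Func S T
      preserves : ∀ σ (a : Func (El (arity σ)) S) →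
                  Setoid._≈_ T (map ⟨$⟩ (𝐒 σ ⟨$⟩ a))
                               (𝐓 σ ⟨$⟩ function a map)

-- The transpose of a map X → S^Y.
flip : {X Y S : Setoid ℓ ℓ} → Func X (Y ⇨ S) → Func Y (X ⇨ S)
flip {Y = Y} {S = S} a = record
  { to   = λ y → record
    { to   = λ x → (a ⟨$⟩ x) ⟨$⟩ y
    ; cong = λ x≈x′ → Func.cong a x≈x′ y
    }
  ; cong = λ y≈y′ x → Func.cong (a ⟨$⟩ x) y≈y′
  }

power : {𝔍 : V ℓ} (Sig : Signature 𝔍 s) {S : Setoid ℓ ℓ} →
        Algebra Sig S → (Y : Setoid ℓ ℓ) → Algebra Sig (Y ⇨ S)
power Sig {S} 𝐒 Y σ = record
  { to   = λ a → function (flip {Y = Y} {S = S} a) (𝐒 σ)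
  ; cong = λ a≈b y → Func.cong (𝐒 σ) (λ j → a≈b j y)
  }

------------------------------------------------------------------------
-- Operations and centralizers

module _ (𝔍 A : V ℓ) where

  record Operation : Set (lsuc ℓ) where
    field
      arity   : V ℓ
      arity∈𝔍 : arity ∈ᵛ 𝔍
      op      : Func (El arity ⇨ El A) (El A)

module _ {𝔍 A : V ℓ} where
  open Operation

  private
    module A = Setoid (El A)

  infix 4 _≋_ _⊥ₒ_

  -- Equality of operations as set-theoretic maps: the arities are equal
  -- sets, and equal arguments have equal values.
  _≋_ : Operation 𝔍 A → Operation 𝔍 A → Set ℓ
  f ≋ g =
    arity f ≈ᵛ arity g ×
    (∀ (a : Func (El (arity f)) (El A)) (b : Func (El (arity g)) (El A)) →
     (∀ i j → el (arity f) i ≈ᵛ el (arity g) j → (a ⟨$⟩ i) A.≈ (b ⟨$⟩ j)) →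
     (op f ⟨$⟩ a) A.≈ (op g ⟨$⟩ b))

  rows : {X Y : Setoid ℓ ℓ} → Func (X ×ₛ Y) (El A) → Func X (Y ⇨ El A)
  rows {X} {Y} a = record
    { to   = λ x → record
      { to   = λ y → a ⟨$⟩ (x , y)
      ; cong = λ y≈y′ → Func.cong a (Setoid.refl X , y≈y′)
      }
    ; cong = λ x≈x′ y → Func.cong a (x≈x′ , Setoid.refl Y)
    }

  columns : {X Y : Setoid ℓ ℓ} → Func (X ×ₛ Y) (El A) → Func Y (X ⇨ El A)
  columns {X} {Y} a = flip {X = X} {Y = Y} {S = El A} (rows a)

  _⊥ₒ_ : Operation 𝔍 A → Operation 𝔍 A → Set ℓ
  f ⊥ₒ g =
    (a : Func (El (arity f) ×ₛ El (arity g)) (El A)) →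
    (op g ⟨$⟩ function (columns a) (op f)) A.≈ (op f ⟨$⟩ function (rows a) (op g))

  infix 25 _^⊥

  _^⊥ : Pred (Operation 𝔍 A) t → Pred (Operation 𝔍 A) (lsuc ℓ ⊔ t)
  (G ^⊥) f = ∀ g → G g → f ⊥ₒ g

module _ {𝔍 : V ℓ} (Sig : Signature 𝔍 s) {A : V ℓ} (𝐀 : Algebra Sig (El A)) where
  open Signature Sig

  basic : Symbol → Operation 𝔍 A
  basic σ = record { arity = arity σ ; arity∈𝔍 = arity∈𝔍 σ ; op = 𝐀 σ }

  -- The set { σᴬ | σ ∈ Σ }.
  basics : Pred (Operation 𝔍 A) (ℓ ⊔ s)
  basics f = ∃ λ σ → f ≋ basic σ

-- u_J, sending j to the projection π_j.
projections : (J A : V ℓ) → Func (El J) ((El J ⇨ El A) ⇨ El A)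
projections J A = record
  { to   = λ j → record { to = λ a → a ⟨$⟩ j ; cong = λ a≈b → a≈b j }
  ; cong = λ i≈j a → Func.cong a i≈j
  }

{-# OPTIONS --safe #-}

-- If K is an arity and g : A^K → A commutes with Σᴬ, then every map r : K → A^J
-- turns g into a homomorphism h(p) = g(p ∘ r) from A^(A^J) to A, and the equation
-- h(f) = f(h ∘ u_J) for it says that f and g agree on the matrix with columns r.
-- Conversely, when some cardinal δ ∈ 𝔍 is equinumerous with A^J, each homomorphism
-- h arises in this way from a δ-ary operation commuting with Σᴬ.  Such a δ exists
-- because J and A embed in a common α-small S, so that sending a map to its graph,
-- coded with Kuratowski pairs, embeds A^J in the threefold power set of S, which
-- is α-small as α is a strong limit; and a setoid T embedding in an ordinal below α
-- is equinumerous with a cardinal below α, namely the collapse of the image of T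
-- in the least such ordinal.  No choice is needed.

module Submission where

open import Defs
open import Axiom.ExcludedMiddle using (ExcludedMiddle)
open import Function.Bundles using (_⇔_; _⟨$⟩_)
open import Function.Construct.Composition using (function)
open import Function.Relation.Binary.Setoid.Equality using (_⇨_)
open import Relation.Binary.Bundles using (Setoid)
open import Relation.Unary using (_∈_)

open import Data.Bool.Base using (true)
open import Data.Bool.Properties using (≡-setoid)
open import Data.Empty using (⊥-elim)
open import Data.Maybe.Base using (just; nothing)
open import Data.Product.Base using (∃; _×_; _,_; proj₁; proj₂)
open import Data.Product.Relation.Binary.Pointwise.NonDependent using (_×ₛ_)
open import Data.Sum.Base using (_⊎_; inj₁; inj₂; [_,_])
open import Function.Bundles using (Func; Injection; Inverse; mk⇔)
open import Function.Construct.Composition using (injection)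
open import Function.Construct.Identity using (inverse)
open import Function.Construct.Symmetry using () renaming (inverse to inverse-sym)
open import Function.Properties.Inverse using (Inverse⇒Injection)
open import Level using (Level) renaming (suc to lsuc)
open import Relation.Binary.PropositionalEquality using (_≡_; refl; sym; trans)
open import Relation.Nullary.Decidable using (Dec; does; yes; no)
open import Relation.Nullary.Negation using (¬_)

private
  variable
    ℓ s p : Level

-- Sets and ordinals

∈ᵛ-respˡ : (x y z : V ℓ) → x ≈ᵛ y → x ∈ᵛ z → y ∈ᵛ z
∈ᵛ-respˡ x y z x≈y (k , e) = k , ≈ᵛ-trans y x (el z k) (≈ᵛ-sym x y x≈y) e

∈ᵛ-respʳ : (x y z : V ℓ) → y ≈ᵛ z → x ∈ᵛ y → x ∈ᵛ z
∈ᵛ-respʳ x (sup J y) (sup K z) (to , _) (j , e) =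
  let (k , e′) = to j in k , ≈ᵛ-trans x (y j) (z k) e e′

el-∈ᵛ : (x : V ℓ) (i : Ix x) → el x i ∈ᵛ x
el-∈ᵛ x i = i , ≈ᵛ-refl (el x i)

≈ᵛ-ext : (x y : V ℓ) → (∀ i → el x i ∈ᵛ y) → (∀ j → el y j ∈ᵛ x) → x ≈ᵛ y
≈ᵛ-ext (sup I x) (sup J y) x⊆y y⊆x =
  x⊆y , λ j → let (i , e) = y⊆x j in i , ≈ᵛ-sym (y j) (x i) e

-- A set belonging to itself equals one of its members, which then belongs to itself too, so
-- structural recursion ends in a contradiction.
∈ᵛ-irrefl : (x : V ℓ) → ¬ x ∈ᵛ x
∈ᵛ-irrefl X@(sup I x) (i , e) =
  ∈ᵛ-irrefl (x i) (∈ᵛ-respʳ (x i) X (x i) e (el-∈ᵛ X i))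

∈-ordinal : (x y : V ℓ) → IsOrdinal x → y ∈ᵛ x → IsOrdinal y
∈-ordinal x y ox y∈x = record
  { transitive         = elementsTransitive y y∈x
  ; elementsTransitive = λ z z∈y → elementsTransitive z (transitive y z z∈y y∈x)
  }
  where open IsOrdinal ox

∈-≤-trans : (x y z : V ℓ) → IsOrdinal z → x ∈ᵛ y → y ≤ᵛ z → x ∈ᵛ z
∈-≤-trans x y z oz x∈y (inj₁ y∈z) = IsOrdinal.transitive oz y x x∈y y∈z
∈-≤-trans x y z oz x∈y (inj₂ y≈z) = ∈ᵛ-respʳ x y z y≈z x∈y

≤-∈-trans : (x y z : V ℓ) → IsOrdinal z → x ≤ᵛ y → y ∈ᵛ z → x ∈ᵛ z
≤-∈-trans x y z oz (inj₁ x∈y) y∈z = IsOrdinal.transitive oz y x x∈y y∈z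
≤-∈-trans x y z oz (inj₂ x≈y) y∈z = ∈ᵛ-respˡ y x z (≈ᵛ-sym x y x≈y) y∈z

-- By induction the rank is the union of the successors of the members of x, and for a transitive x
-- this union is x. It turns smallness of a cardinal into membership in κ.
rank-ordinal : (x : V ℓ) → IsOrdinal x → rank x ≈ᵛ x
rank-ordinal X@(sup I x) oX = ≈ᵛ-ext (rank X) X rank⊆ ⊆rank
  where
  rank≈ : ∀ i → rank (x i) ≈ᵛ x i
  rank≈ i = rank-ordinal (x i) (∈-ordinal X (x i) oX (el-∈ᵛ X i))

  rank⊆ : ∀ k → el (rank X) k ∈ᵛ X
  rank⊆ (i , just k) = IsOrdinal.transitive oX (x i) (el (rank (x i)) k)
    (∈ᵛ-respʳ (el (rank (x i)) k) (rank (x i)) (x i) (rank≈ i) (el-∈ᵛ (rank (x i)) k))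
    (el-∈ᵛ X i)
  rank⊆ (i , nothing) = i , rank≈ i

  ⊆rank : ∀ i → x i ∈ᵛ rank X
  ⊆rank i = (i , nothing) , ≈ᵛ-sym (rank (x i)) (x i) (rank≈ i)

subset-injection : (x y : V ℓ) → (∀ i → el x i ∈ᵛ y) → Injection (El x) (El y)
subset-injection x y x⊆y = record
  { to        = λ i → proj₁ (x⊆y i)
  ; cong      = λ {i} {j} i≈j →
      let (k , e) = x⊆y i ; (l , e′) = x⊆y j in
      ≈ᵛ-trans (el y k) (el x i) (el y l) (≈ᵛ-sym (el x i) (el y k) e)
        (≈ᵛ-trans (el x i) (el x j) (el y l) i≈j e′)
  ; injective = λ {i} {j} k≈l →
      let (k , e) = x⊆y i ; (l , e′) = x⊆y j in
      ≈ᵛ-trans (el x i) (el y k) (el x j) e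
        (≈ᵛ-trans (el y k) (el y l) (el x j) k≈l (≈ᵛ-sym (el x j) (el y l) e′))
  }

-- Collapsing subsets of ordinals

-- The Mostowski collapse. For an ordinal x it is the order type of the members of x satisfying P; P
-- is not tested at x itself.
collapse : (V ℓ → Set ℓ) → V ℓ → V ℓ
collapse P (sup I x) = sup (∃ λ i → P (x i)) (λ (i , _) → collapse P (x i))

module Collapse (P : V ℓ → Set ℓ) (P-resp : ∀ x y → x ≈ᵛ y → P x → P y) where

  private
    c : V ℓ → V ℓ
    c = collapse P

  collapse-cong : (x y : V ℓ) → x ≈ᵛ y → c x ≈ᵛ c y
  collapse-cong (sup I x) (sup J y) (to , from) =
    (λ (i , Pxi) → let (j , e) = to i in
      (j , P-resp (x i) (y j) e Pxi) , collapse-cong (x i) (y j) e) ,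
    (λ (j , Pyj) → let (i , e) = from j in
      (i , P-resp (y j) (x i) (≈ᵛ-sym (x i) (y j) e) Pyj) ,
      collapse-cong (x i) (y j) e)

  ∈-collapse⁺ : (x y : V ℓ) → y ∈ᵛ x → P y → c y ∈ᵛ c x
  ∈-collapse⁺ (sup I x) y (i , e) Py =
    (i , P-resp y (x i) e Py) , collapse-cong y (x i) e

  ∈-collapse⁻ : (x z : V ℓ) → z ∈ᵛ c x → ∃ λ y → y ∈ᵛ x × P y × z ≈ᵛ c y
  ∈-collapse⁻ X@(sup I x) z ((i , Pxi) , e) = x i , el-∈ᵛ X i , Pxi , e

  collapse-transitive : (x : V ℓ) → IsTransitive x → IsTransitive (c x)
  collapse-transitive x tx w z z∈w w∈cx =
    let (y , y∈x , _ , w≈cy) = ∈-collapse⁻ x w w∈cx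
        (u , u∈y , Pu , z≈cu) = ∈-collapse⁻ y z (∈ᵛ-respʳ z w (c y) w≈cy z∈w)
    in ∈ᵛ-respˡ (c u) z (c x) (≈ᵛ-sym z (c u) z≈cu)
         (∈-collapse⁺ x u (tx y u u∈y y∈x) Pu)

  collapse-ordinal : (x : V ℓ) → IsOrdinal x → IsOrdinal (c x)
  collapse-ordinal x ox = record
    { transitive         = collapse-transitive x transitive
    ; elementsTransitive = λ w w∈cx v z z∈v v∈w →
        let (y , y∈x , _ , w≈cy) = ∈-collapse⁻ x w w∈cx in
        ∈ᵛ-respʳ z (c y) w (≈ᵛ-sym w (c y) w≈cy)
          (collapse-transitive y (elementsTransitive y y∈x) v z z∈v
            (∈ᵛ-respʳ v w (c y) w≈cy v∈w))
    }
    where open IsOrdinal ox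

-- The images are sets rather than indices into x, so replacing x by an equal set leaves them
-- unchanged.
record Embedding (T : Setoid ℓ ℓ) (x : V ℓ) : Set (lsuc ℓ) where
  open Setoid T
  field
    image     : Carrier → V ℓ
    image∈    : ∀ t → image t ∈ᵛ x
    cong      : ∀ {t u} → t ≈ u → image t ≈ᵛ image u
    injective : ∀ {t u} → image t ≈ᵛ image u → t ≈ u

Injection⇒Embedding : {T : Setoid ℓ ℓ} (x : V ℓ) → Injection T (El x) → Embedding T x
Injection⇒Embedding x ι = record
  { image     = λ t → el x (Injection.to ι t)
  ; image∈    = λ t → el-∈ᵛ x (Injection.to ι t)
  ; cong      = Injection.cong ι
  ; injective = Injection.injective ι
  }

Embedding-resp : {T : Setoid ℓ ℓ} (x y : V ℓ) → x ≈ᵛ y → Embedding T x → Embedding T y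
Embedding-resp x y x≈y ι = record
  { image     = image
  ; image∈    = λ t → ∈ᵛ-respʳ (image t) x y x≈y (image∈ t)
  ; cong      = cong
  ; injective = injective
  }
  where open Embedding ι

-- Cardinalities

module Classical (em : ∀ {p} → ExcludedMiddle p) where

  -- If a member of one ordinal is at least the other ordinal, transitivity decides. Otherwise the
  -- comparisons with members put each ordinal inside the other, and extensionality makes them
  -- equal.
  compare-step : (x y : V ℓ) → IsOrdinal x → IsOrdinal y →
                 (∀ i → el x i ≤ᵛ y ⊎ y ∈ᵛ el x i) →
                 (∀ j → x ≤ᵛ el y j ⊎ el y j ∈ᵛ x) → x ≤ᵛ y ⊎ y ∈ᵛ x
  compare-step x y ox oy cmpˡ cmpʳ = decide em em
    where
    decide : Dec (∃ λ i → y ≤ᵛ el x i) → Dec (∃ λ j → x ≤ᵛ el y j) → x ≤ᵛ y ⊎ y ∈ᵛ x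
    decide (yes (i , y≤xi)) _ = inj₂ (≤-∈-trans y (el x i) x ox y≤xi (el-∈ᵛ x i))
    decide (no _) (yes (j , x≤yj)) =
      inj₁ (inj₁ (≤-∈-trans x (el y j) y oy x≤yj (el-∈ᵛ y j)))
    decide (no y≰) (no x≰) = inj₁ (inj₂ (≈ᵛ-ext x y x⊆y y⊆x))
      where
      x⊆y : ∀ i → el x i ∈ᵛ y
      x⊆y i = [ [ (λ xi∈y → xi∈y)
                , (λ xi≈y → ⊥-elim (y≰ (i , inj₂ (≈ᵛ-sym (el x i) y xi≈y)))) ]
              , (λ y∈xi → ⊥-elim (y≰ (i , inj₁ y∈xi))) ] (cmpˡ i)

      y⊆x : ∀ j → el y j ∈ᵛ x
      y⊆x j = [ (λ x≤yj → ⊥-elim (x≰ (j , x≤yj))) , (λ yj∈x → yj∈x) ] (cmpʳ j)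

  compare : (x y : V ℓ) → IsOrdinal x → IsOrdinal y → x ≤ᵛ y ⊎ y ∈ᵛ x
  compare X@(sup I x) Y@(sup J y) oX oY = compare-step X Y oX oY
    (λ i → compare (x i) Y (∈-ordinal X (x i) oX (el-∈ᵛ X i)) oY)
    (λ j → compare X (y j) oX (∈-ordinal Y (y j) oY (el-∈ᵛ Y j)))

  -- Excluded middle either finds a member satisfying Q, to which the recursion descends, or shows
  -- that there is none.
  least : (Q : V ℓ → Set p) (x : V ℓ) → Q x → ∃ λ y → Q y × (∀ i → ¬ Q (el y i))
  least Q X@(sup I x) QX with em {P = ∃ λ i → Q (x i)}
  ... | yes (i , Qxi) = least Q (x i) Qxi
  ... | no ¬Q         = X , QX , λ i Qxi → ¬Q (i , Qxi)

  module _ (P : V ℓ → Set ℓ) (P-resp : ∀ x y → x ≈ᵛ y → P x → P y) where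
    open Collapse P P-resp

    -- Were X a member of its collapse, it would equal the collapse of some member x i. By induction
    -- that collapse is at most x i, so X would be a member of itself.
    collapse-≤ : (x : V ℓ) → IsOrdinal x → collapse P x ≤ᵛ x
    collapse-≤ X@(sup I x) oX with compare (collapse P X) X (collapse-ordinal X oX) oX
    ... | inj₁ cX≤X = cX≤X
    ... | inj₂ ((i , _) , X≈c) =
      ⊥-elim (∈ᵛ-irrefl X (≤-∈-trans X (x i) X oX X≤xi (el-∈ᵛ X i)))
      where
      X≤xi : X ≤ᵛ x i
      X≤xi with collapse-≤ (x i) (∈-ordinal X (x i) oX (el-∈ᵛ X i))
      ... | inj₁ c∈ = inj₁ (∈ᵛ-respˡ (collapse P (x i)) X (x i)
                              (≈ᵛ-sym X (collapse P (x i)) X≈c) c∈)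
      ... | inj₂ c≈ = inj₂ (≈ᵛ-trans X (collapse P (x i)) (x i) X≈c c≈)

    collapse-∉ : (x y : V ℓ) → P x → collapse P x ≈ᵛ collapse P y → ¬ x ∈ᵛ y
    collapse-∉ x y Px cx≈cy x∈y = ∈ᵛ-irrefl (collapse P x)
      (∈ᵛ-respʳ (collapse P x) (collapse P y) (collapse P x)
        (≈ᵛ-sym (collapse P x) (collapse P y) cx≈cy) (∈-collapse⁺ y x x∈y Px))

    -- Ordinals are comparable, and a strict membership between x and y would carry over to their
    -- collapses, making one of these a member of itself.
    collapse-injective : (x y : V ℓ) → IsOrdinal x → IsOrdinal y → P x → P y →
                         collapse P x ≈ᵛ collapse P y → x ≈ᵛ y
    collapse-injective x y ox oy Px Py cx≈cy with compare x y ox oy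
    ... | inj₁ (inj₁ x∈y) = ⊥-elim (collapse-∉ x y Px cx≈cy x∈y)
    ... | inj₁ (inj₂ x≈y) = x≈y
    ... | inj₂ y∈x        = ⊥-elim (collapse-∉ y x Py
                              (≈ᵛ-sym (collapse P x) (collapse P y) cx≈cy) y∈x)

  -- The image of T is collapsed. An index of the collapse stores an element of T as the witness of
  -- P, so the inverse map is a projection and calls for no choice.
  collapse-embedding : {T : Setoid ℓ ℓ} (x : V ℓ) → IsOrdinal x → Embedding T x →
                       ∃ λ y → IsOrdinal y × y ≤ᵛ x × T ≅ El y
  collapse-embedding {ℓ = ℓ} {T = T} X@(sup I x) oX ι =
    collapse P X , collapse-ordinal X oX , collapse-≤ P P-resp X oX , record
      { to        = to
      ; from      = λ (_ , t , _) → t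
      ; to-cong   = λ {t} {u} t≈u → collapse-cong (x (ix t)) (x (ix u))
          (≈ᵛ-trans (x (ix t)) (image t) (x (ix u))
            (≈ᵛ-sym (image t) (x (ix t)) (proj₂ (image∈ t)))
            (≈ᵛ-trans (image t) (image u) (x (ix u)) (cong t≈u) (proj₂ (image∈ u))))
      ; from-cong = λ {k} {l} → reflect k l
      ; inverse   = (λ {k} {t} → to-from k t) , λ {t} {k} → reflect k (to t)
      }
    where
    open Embedding ι
    module T = Setoid T

    P : V ℓ → Set ℓ
    P y = ∃ λ t → image t ≈ᵛ y

    P-resp : ∀ y z → y ≈ᵛ z → P y → P z
    P-resp y z y≈z (t , e) = t , ≈ᵛ-trans (image t) y z e y≈z

    open Collapse P P-resp

    ix : T.Carrier → I
    ix t = proj₁ (image∈ t)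

    to : T.Carrier → Ix (collapse P X)
    to t = ix t , t , proj₂ (image∈ t)

    reflect : ∀ k l → el (collapse P X) k ≈ᵛ el (collapse P X) l →
              proj₁ (proj₂ k) T.≈ proj₁ (proj₂ l)
    reflect (i , t , e) (j , u , e′) ci≈cj = injective
      (≈ᵛ-trans (image t) (x i) (image u) e
        (≈ᵛ-trans (x i) (x j) (image u)
          (collapse-injective P P-resp (x i) (x j) (ordinal i) (ordinal j)
            (t , e) (u , e′) ci≈cj)
          (≈ᵛ-sym (image u) (x j) e′)))
      where
      ordinal : ∀ i → IsOrdinal (x i)
      ordinal i = ∈-ordinal X (x i) oX (el-∈ᵛ X i)

    to-from : ∀ k t → t T.≈ proj₁ (proj₂ k) →
              el (collapse P X) (to t) ≈ᵛ el (collapse P X) k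
    to-from (i , u , e) t t≈u = collapse-cong (x (ix t)) (x i)
      (≈ᵛ-trans (x (ix t)) (image t) (x i)
        (≈ᵛ-sym (image t) (x (ix t)) (proj₂ (image∈ t)))
        (≈ᵛ-trans (image t) (image u) (x i) (cong t≈u) e))

  Embedding⇒∣∣< : {T : Setoid ℓ ℓ} (α β : V ℓ) → IsOrdinal α → β ∈ᵛ α →
                  Embedding T β → ∣ T ∣< α
  Embedding⇒∣∣< {T = T} α β oα β∈α ι
    with least (λ γ → γ ∈ᵛ α × Embedding T γ) β (β∈α , ι)
  ... | γ , (γ∈α , ι′) , γ-least
    with collapse-embedding γ (∈-ordinal α γ oα γ∈α) ι′
  ... | δ , oδ , δ≤γ , T≅δ = δ ,
    record { isOrdinal = oδ ; initial = initial } , T≅δ , ≤-∈-trans δ γ α oα δ≤γ γ∈α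
    where
    initial : ∀ y → y ∈ᵛ δ → ¬ (El y ≅ El δ)
    initial y y∈δ y≅δ =
      -- A smaller ordinal equinumerous with δ would also receive T. Minimality of γ speaks of the
      -- indexed members of γ, so the embedding is moved to the member equal to y.
      let y∈γ@(i , y≈γi) = ∈-≤-trans y δ γ (∈-ordinal α γ oα γ∈α) y∈δ δ≤γ in
      γ-least i
        ( IsOrdinal.transitive oα γ (el γ i) (el-∈ᵛ γ i) γ∈α
        , Embedding-resp y (el γ i) y≈γi (Injection⇒Embedding y
            (injection (Inverse⇒Injection T≅δ) (Inverse⇒Injection (inverse-sym y≅δ))))
        )

  ∣∣<-injection : {S T : Setoid ℓ ℓ} (α : V ℓ) → IsOrdinal α →
                  Injection T S → ∣ S ∣< α → ∣ T ∣< α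
  ∣∣<-injection α oα T↣S (β , _ , S≅β , β∈α) =
    Embedding⇒∣∣< α β oα β∈α
      (Injection⇒Embedding β (injection T↣S (Inverse⇒Injection S≅β)))

  -- The two cardinals are comparable, so whichever of S and T has the larger one serves as U.
  ∣∣<-upperBound : {S T : Setoid ℓ ℓ} (α : V ℓ) → IsOrdinal α → ∣ S ∣< α → ∣ T ∣< α →
                   ∃ λ U → ∣ U ∣< α × Injection S U × Injection T U
  ∣∣<-upperBound {S = S} {T} α oα ∣S∣<α@(β , cβ , S≅β , _) ∣T∣<α@(γ , cγ , T≅γ , _) =
    bound (compare β γ (IsCardinal.isOrdinal cβ) oγ)
    where
    oβ = IsCardinal.isOrdinal cβ
    oγ = IsCardinal.isOrdinal cγ

    embed : {S T : Setoid _ _} (β γ : V _) → IsOrdinal γ → β ≤ᵛ γ →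
            S ≅ El β → T ≅ El γ → Injection S T
    embed β γ oγ β≤γ S≅β T≅γ =
      injection (Inverse⇒Injection S≅β)
        (injection (subset-injection β γ
                     (λ i → ∈-≤-trans (el β i) β γ oγ (el-∈ᵛ β i) β≤γ))
                   (Inverse⇒Injection (inverse-sym T≅γ)))

    bound : β ≤ᵛ γ ⊎ γ ∈ᵛ β → ∃ λ U → ∣ U ∣< α × Injection S U × Injection T U
    bound (inj₁ β≤γ) = T , ∣T∣<α , embed β γ oγ β≤γ S≅β T≅γ , Inverse⇒Injection (inverse T)
    bound (inj₂ γ∈β) =
      S , ∣S∣<α , Inverse⇒Injection (inverse S) , embed γ β oβ (inj₁ γ∈β) T≅γ S≅β

-- Power sets

  𝒫 : Setoid ℓ ℓ → Setoid ℓ ℓ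
  𝒫 S = S ⇨ ≡-setoid

  does⁺ : {P : Set p} → P → does (em {P = P}) ≡ true
  does⁺ {P = P} x with em {P = P}
  ... | yes _ = refl
  ... | no ¬x = ⊥-elim (¬x x)

  does⁻ : {P : Set p} → does (em {P = P}) ≡ true → P
  does⁻ {P = P} _ with em {P = P}
  does⁻ _  | yes x = x
  does⁻ () | no _

  does-⇔ : ∀ {q} {P : Set p} {Q : Set q} → (P → Q) → (Q → P) →
           does (em {P = P}) ≡ does (em {P = Q})
  does-⇔ {P = P} {Q} to from with em {P = P} | em {P = Q}
  ... | yes _ | yes _ = refl
  ... | yes x | no ¬y = ⊥-elim (¬y (to x))
  ... | no ¬x | yes y = ⊥-elim (¬x (from y))
  ... | no _  | no _  = refl

  module _ {S : Setoid ℓ ℓ} where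
    private module S = Setoid S

    -- Deciding P by excluded middle gives a Boolean-valued map, so the subset stays at level ℓ
    -- whatever the level of P.
    subset : (P : S.Carrier → Set p) → (∀ {x y} → x S.≈ y → P x → P y) →
             Setoid.Carrier (𝒫 S)
    subset P P-resp = record
      { to   = λ x → does (em {P = P x})
      ; cong = λ x≈y → does-⇔ (P-resp x≈y) (P-resp (S.sym x≈y))
      }

    doubleton : S.Carrier → S.Carrier → Setoid.Carrier (𝒫 S)
    doubleton x y = subset (λ z → z S.≈ x ⊎ z S.≈ y) λ where
      z≈w (inj₁ z≈x) → inj₁ (S.trans (S.sym z≈w) z≈x)
      z≈w (inj₂ z≈y) → inj₂ (S.trans (S.sym z≈w) z≈y)

    ∈-doubleton⁻ : ∀ x y z → doubleton x y ⟨$⟩ z ≡ true → z S.≈ x ⊎ z S.≈ y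
    ∈-doubleton⁻ x y z = does⁻

    -- Classically, X is {x} or {x, y}.
    IsPairMember : S.Carrier → S.Carrier → Setoid.Carrier (𝒫 S) → Set ℓ
    IsPairMember x y X = X ⟨$⟩ x ≡ true × (∀ z → X ⟨$⟩ z ≡ true → z S.≈ x ⊎ z S.≈ y)

  -- Kuratowski pairs

  module _ {S : Setoid ℓ ℓ} where
    private
      module S = Setoid S
      module 𝒫𝒫 = Setoid (𝒫 (𝒫 S))

    kuratowski : S.Carrier → S.Carrier → 𝒫𝒫.Carrier
    kuratowski x y = subset {S = 𝒫 S} (IsPairMember {S = S} x y) λ X≈Y (x∈ , ⊆) →
      trans (sym (X≈Y x)) x∈ , λ z z∈ → ⊆ z (trans (X≈Y z) z∈)

    kuratowski-cong : ∀ {x y x′ y′} → x S.≈ x′ → y S.≈ y′ →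
                      kuratowski x y 𝒫𝒫.≈ kuratowski x′ y′
    kuratowski-cong x≈x′ y≈y′ X = does-⇔
      (member x≈x′ y≈y′) (member (S.sym x≈x′) (S.sym y≈y′))
      where
      member : ∀ {x y x′ y′} → x S.≈ x′ → y S.≈ y′ →
               IsPairMember {S = S} x y X → IsPairMember {S = S} x′ y′ X
      member x≈x′ y≈y′ (x∈ , ⊆) =
        trans (sym (Func.cong X x≈x′)) x∈ , λ z z∈ → case (⊆ z z∈)
        where
        case : ∀ {z} → z S.≈ _ ⊎ z S.≈ _ → z S.≈ _ ⊎ z S.≈ _
        case (inj₁ e) = inj₁ (S.trans e x≈x′)
        case (inj₂ e) = inj₂ (S.trans e y≈y′)

    kuratowski-transfer : ∀ {x y x′ y′} X → kuratowski x y 𝒫𝒫.≈ kuratowski x′ y′ →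
                          IsPairMember {S = S} x y X → IsPairMember {S = S} x′ y′ X
    kuratowski-transfer X eq m = does⁻ (trans (sym (eq X)) (does⁺ m))

    -- The singleton of x belongs to the first pair, hence to the second, all of whose members
    -- contain x′.
    kuratowski-injectiveˡ : ∀ {x y x′ y′} → kuratowski x y 𝒫𝒫.≈ kuratowski x′ y′ →
                            x S.≈ x′
    kuratowski-injectiveˡ {x} {y} {x′} {y′} eq
      with ∈-doubleton⁻ {S = S} x x x′ (proj₁
             (kuratowski-transfer {x} {y} {x′} {y′} (doubleton {S = S} x x) eq
             (does⁺ (inj₁ S.refl) , λ z z∈ → inj₁ (x≈ (∈-doubleton⁻ {S = S} x x z z∈)))))
      where
      x≈ : ∀ {z} → z S.≈ x ⊎ z S.≈ x → z S.≈ x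
      x≈ (inj₁ e) = e
      x≈ (inj₂ e) = e
    ... | inj₁ x′≈x = S.sym x′≈x
    ... | inj₂ x′≈x = S.sym x′≈x

    -- The doubleton of x and y belongs to the second pair too, so it lies within the doubleton of
    -- x′ and y′.
    kuratowski-second : ∀ {x y x′ y′} → kuratowski x y 𝒫𝒫.≈ kuratowski x′ y′ →
                        y S.≈ x′ ⊎ y S.≈ y′
    kuratowski-second {x} {y} {x′} {y′} eq =
      proj₂ (kuratowski-transfer {x} {y} {x′} {y′} (doubleton {S = S} x y) eq
              (does⁺ (inj₁ S.refl) , ∈-doubleton⁻ {S = S} x y))
            y (does⁺ (inj₂ S.refl))

    kuratowski-injectiveʳ : ∀ {x y x′ y′} → kuratowski x y 𝒫𝒫.≈ kuratowski x′ y′ →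
                            y S.≈ y′
    kuratowski-injectiveʳ {x} {y} {x′} {y′} eq
      with kuratowski-second {x} {y} {x′} {y′} eq
         | kuratowski-second {x′} {y′} {x} {y} (λ X → sym (eq X))
    ... | inj₂ y≈y′ | _         = y≈y′
    ... | inj₁ y≈x′ | inj₂ y′≈y = S.sym y′≈y
    -- In the crossed case the equality of first components closes the chain y, x′, x, y′.
    ... | inj₁ y≈x′ | inj₁ y′≈x = S.trans y≈x′
      (S.trans (S.sym (kuratowski-injectiveˡ {x} {y} {x′} {y′} eq)) (S.sym y′≈x))

  graph-injection : {S T U : Setoid ℓ ℓ} → Injection S U → Injection T U →
                    Injection (S ⇨ T) (𝒫 (𝒫 (𝒫 U)))
  graph-injection {S = S} {T} {U} ι κ = record
    { to        = graph
    ; cong      = λ {f} {g} f≈g W → does-⇔ (graph-mono f g f≈g W)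
                    (graph-mono g f (λ x → T.sym (f≈g x)) W)
    ; injective = λ {f} {g} → graph-injective f g
    }
    where
    module S = Setoid S
    module T = Setoid T
    module 𝒫𝒫 = Setoid (𝒫 (𝒫 U))
    module ι = Injection ι
    module κ = Injection κ

    pair : S.Carrier → T.Carrier → 𝒫𝒫.Carrier
    pair x y = kuratowski {S = U} (ι.to x) (κ.to y)

    InGraph : Func S T → 𝒫𝒫.Carrier → Set _
    InGraph f W = ∃ λ x → W 𝒫𝒫.≈ pair x (f ⟨$⟩ x)

    graph : Func S T → Setoid.Carrier (𝒫 (𝒫 (𝒫 U)))
    graph f = subset {S = 𝒫 (𝒫 U)} (InGraph f) λ V≈W (x , e) →
      x , λ X → trans (sym (V≈W X)) (e X)

    graph-mono : ∀ f g → (∀ x → (f ⟨$⟩ x) T.≈ (g ⟨$⟩ x)) → ∀ W → InGraph f W → InGraph g W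
    graph-mono f g f≈g W (x , e) = x , λ X → trans (e X)
      (kuratowski-cong {S = U} (Setoid.refl U) (κ.cong (f≈g x)) X)

    graph-injective : ∀ f g → (∀ W → (graph f ⟨$⟩ W) ≡ (graph g ⟨$⟩ W)) →
                      ∀ x → (f ⟨$⟩ x) T.≈ (g ⟨$⟩ x)
    graph-injective f g eq x =
      let W = pair x (f ⟨$⟩ x)
          -- The pair of x and f(x) lies in the graph of f, hence in that of g, so it is the pair of
          -- some x′ and g(x′).
          (x′ , e) = does⁻ {P = InGraph g W} (trans (sym (eq W)) (does⁺ (x , λ _ → refl)))
          x≈x′ = ι.injective (kuratowski-injectiveˡ {S = U} {y′ = κ.to (g ⟨$⟩ x′)} e)
          fx≈gx′ = κ.injective (kuratowski-injectiveʳ {S = U} {x = ι.to x} {x′ = ι.to x′} e)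
      in T.trans fx≈gx′ (Func.cong g (S.sym x≈x′))

  -- Powers below a strong limit

  module _ (α : V ℓ) (oα : IsOrdinal α) (lim : IsStrongLimit α) where

    -- The strong limit property concerns power sets of cardinals, so subsets of S are first carried
    -- over to the cardinal β of S.
    ∣∣<-𝒫 : {S : Setoid ℓ ℓ} → ∣ S ∣< α → ∣ 𝒫 S ∣< α
    ∣∣<-𝒫 {S} (β , cβ , S≅β , β∈α) = ∣∣<-injection α oα restrict (lim β cβ β∈α)
      where
      module S≅β = Inverse S≅β

      restrict : Injection (𝒫 S) (𝒫 (El β))
      restrict = record
        { to        = λ X → function (record { to = S≅β.from ; cong = S≅β.from-cong }) X
        ; cong      = λ X≈Y i → X≈Y (S≅β.from i)
        ; injective = λ {X} {Y} X≈Y x →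
            let x≈ = S≅β.strictlyInverseʳ x in
            trans (sym (Func.cong X x≈)) (trans (X≈Y (S≅β.to x)) (Func.cong Y x≈))
        }

    ∣∣<-⇨ : {S T : Setoid ℓ ℓ} → ∣ S ∣< α → ∣ T ∣< α → ∣ S ⇨ T ∣< α
    ∣∣<-⇨ ∣S∣<α ∣T∣<α =
      let (U , ∣U∣<α , ι , κ) = ∣∣<-upperBound α oα ∣S∣<α ∣T∣<α in
      ∣∣<-injection α oα (graph-injection ι κ) (∣∣<-𝒫 (∣∣<-𝒫 (∣∣<-𝒫 ∣U∣<α)))

-- Operations and homomorphisms

≈ᵛ⇒Func : (x y : V ℓ) → x ≈ᵛ y → Func (El y) (El x)
≈ᵛ⇒Func x y x≈y = record { to = Injection.to ι ; cong = Injection.cong ι }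
  where
  ι = subset-injection y x λ i → ∈ᵛ-respʳ (el y i) y x (≈ᵛ-sym x y x≈y) (el-∈ᵛ y i)

≈ᵛ⇒Func-≈ : (x y : V ℓ) (x≈y : x ≈ᵛ y) (j : Ix y) →
            el x (≈ᵛ⇒Func x y x≈y ⟨$⟩ j) ≈ᵛ el y j
≈ᵛ⇒Func-≈ x y x≈y j =
  ≈ᵛ-sym (el y j) _ (proj₂ (∈ᵛ-respʳ (el y j) y x (≈ᵛ-sym x y x≈y) (el-∈ᵛ y j)))

module _ {𝔍 A : V ℓ} where
  open Operation
  private module A = Setoid (El A)

  -- The arities of k and g are equal sets with possibly different indexings, so the matrix is
  -- reindexed. This reduces commuting with all of `basics` to commuting with each `basic σ`.
  ⊥ₒ-respʳ : (f g k : Operation 𝔍 A) → k ≋ g → f ⊥ₒ g → f ⊥ₒ k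
  ⊥ₒ-respʳ f g k (k≈g , ≈op) f⊥g a =
    A.trans (≈op (function (columns {𝔍 = 𝔍} {A} {El (arity f)} {El (arity k)} a) (op f)) (function (columns {𝔍 = 𝔍} {A} {El (arity f)} {El (arity g)} a′) (op f))
              λ i j i≈j → Func.cong (op f) λ x → a≈ i j x i≈j)
      (A.trans (f⊥g a′)
        (Func.cong (op f) λ x →
          A.sym (≈op (rows {𝔍 = 𝔍} {A} {El (arity f)} {El (arity k)} a ⟨$⟩ x) (rows {𝔍 = 𝔍} {A} {El (arity f)} {El (arity g)} a′ ⟨$⟩ x)
            λ i j i≈j → a≈ i j x i≈j)))
    where
    r : Func (El (arity g)) (El (arity k))
    r = ≈ᵛ⇒Func (arity k) (arity g) k≈g

    a′ : Func (El (arity f) ×ₛ El (arity g)) (El A)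
    a′ = record
      { to   = λ (x , j) → a ⟨$⟩ (x , r ⟨$⟩ j)
      ; cong = λ (x≈y , i≈j) → Func.cong a (x≈y , Func.cong r i≈j)
      }

    a≈ : ∀ i j x → el (arity k) i ≈ᵛ el (arity g) j →
         (a ⟨$⟩ (x , i)) A.≈ (a′ ⟨$⟩ (x , j))
    a≈ i j x i≈j = Func.cong a
      ( ≈ᵛ-refl (el (arity f) x)
      , ≈ᵛ-trans (el (arity k) i) (el (arity g) j) _ i≈j
          (≈ᵛ-sym _ (el (arity g) j) (≈ᵛ⇒Func-≈ (arity k) (arity g) k≈g j)))

module _ {𝔍 : V ℓ} (Sig : Signature 𝔍 s) {A : V ℓ} (𝐀 : Algebra Sig (El A))
         (Y : Setoid ℓ ℓ) where
  open Operation
  private module A = Setoid (El A)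

  Hom⇒Operation : (δ : V ℓ) → δ ∈ᵛ 𝔍 → Func Y (El δ) →
                  Func (Y ⇨ El A) (El A) → Operation 𝔍 A
  Hom⇒Operation δ δ∈𝔍 φ h = record
    { arity   = δ
    ; arity∈𝔍 = δ∈𝔍
    ; op      = record
      { to   = λ b → h ⟨$⟩ function φ b
      ; cong = λ b≈c → Func.cong h λ y → b≈c (φ ⟨$⟩ y)
      }
    }

  -- Pulled back along φ, the columns of a matrix form an argument of σ in the power algebra; that h
  -- preserves σ there is the commuting equation.
  Hom⇒Operation∈⊥ : ∀ δ δ∈𝔍 φ (h : Hom Sig (power Sig 𝐀 Y) 𝐀) →
                    Hom⇒Operation δ δ∈𝔍 φ (Hom.map h) ∈ basics Sig {A} 𝐀 ^⊥
  Hom⇒Operation∈⊥ δ δ∈𝔍 φ h k (σ , k≋σ) =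
    ⊥ₒ-respʳ g (basic Sig {A} 𝐀 σ) k k≋σ λ a → A.sym (Hom.preserves h σ (record
      { to   = λ j → function φ (columns {𝔍 = 𝔍} {A} a ⟨$⟩ j)
      ; cong = λ i≈j y → Func.cong (columns {𝔍 = 𝔍} {A} a) i≈j (φ ⟨$⟩ y)
      }))
    where
    g = Hom⇒Operation δ δ∈𝔍 φ (Hom.map h)

  -- Preservation of σ at a is the commuting of g with `basic σ` on the matrix whose column x is the
  -- pullback of `a ⟨$⟩ x` along r.
  Operation⇒Hom : (g : Operation 𝔍 A) → g ∈ basics Sig {A} 𝐀 ^⊥ →
                  Func (El (arity g)) Y → Hom Sig (power Sig 𝐀 Y) 𝐀
  Operation⇒Hom g g∈⊥ r = record
    { map       = record
      { to   = λ q → op g ⟨$⟩ function r q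
      ; cong = λ q≈q′ → Func.cong (op g) λ k → q≈q′ (r ⟨$⟩ k)
      }
    -- A map carries its congruence proof; the outer steps only exchange these.
    ; preserves = λ σ a →
        A.trans (Func.cong (op g) λ k → Func.cong (𝐀 σ) λ j → A.refl)
          (A.trans (A.sym (g∈⊥ (basic Sig {A} 𝐀 σ) (basic∈basics σ) (matrix a)))
            (Func.cong (𝐀 σ) λ j → Func.cong (op g) λ k → A.refl))
    }
    where
    open Signature Sig using () renaming (arity to arityₛ)

    matrix : ∀ {X} → Func X (Y ⇨ El A) → Func (El (arity g) ×ₛ X) (El A)
    matrix a = record
      { to   = λ (k , x) → (a ⟨$⟩ x) ⟨$⟩ (r ⟨$⟩ k)
      ; cong = λ {(k , x)} {(k′ , x′)} (k≈k′ , x≈x′) →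
          A.trans (Func.cong a x≈x′ (r ⟨$⟩ k)) (Func.cong (a ⟨$⟩ x′) (Func.cong r k≈k′))
      }

    basic∈basics : ∀ σ → basic Sig {A} 𝐀 σ ∈ basics Sig {A} 𝐀
    basic∈basics σ = σ , ≈ᵛ-refl (arityₛ σ) ,
      λ a b a≈b → Func.cong (𝐀 σ) λ i → a≈b i i (≈ᵛ-refl (el (arityₛ σ) i))

-- An ordinal is its own rank, so β is small because it lies below α and hence below κ.
cardinal∈𝔍 : (κ α β 𝔍 : V ℓ) → IsOrdinal κ → α ≤ᵛ κ →
             (∀ J → IsCardinal J → IsαSmall κ α J → J ∈ᵛ 𝔍) →
             IsCardinal β → β ∈ᵛ α → β ∈ᵛ 𝔍
cardinal∈𝔍 κ α β 𝔍 oκ α≤κ Card⊆𝔍 cβ β∈α = Card⊆𝔍 β cβ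
  ( ∈ᵛ-respˡ β (rank β) κ (≈ᵛ-sym (rank β) β (rank-ordinal β (IsCardinal.isOrdinal cβ)))
      (∈-≤-trans β α κ oκ β∈α α≤κ)
  , β , cβ , inverse (El β) , β∈α )

-- The two inclusions

module _ {𝔍 : V ℓ} (Sig : Signature 𝔍 s) {A : V ℓ} (𝐀 : Algebra Sig (El A))
         (f : Operation 𝔍 A) where
  private
    module A = Setoid (El A)

    J  = Operation.arity f
    fᴬ = Operation.op f
    Aᴶ = El J ⇨ El A

  CommutesWithHoms : Set _
  CommutesWithHoms = (h : Hom Sig (power Sig 𝐀 Aᴶ) 𝐀) →
    (Hom.map h ⟨$⟩ fᴬ) A.≈ (fᴬ ⟨$⟩ function (projections J A) (Hom.map h))

  ∈⊥⊥⇒commutesWithHoms : (δ : V ℓ) → δ ∈ᵛ 𝔍 → Aᴶ ≅ El δ →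
                         f ∈ (basics Sig {A} 𝐀 ^⊥) ^⊥ → CommutesWithHoms
  ∈⊥⊥⇒commutesWithHoms δ δ∈𝔍 Aᴶ≅δ f∈⊥⊥ h =
    A.trans (Func.cong H λ b → Func.cong fᴬ λ j → A.sym (φ⁻¹∘φ b j))
      (A.trans (f∈⊥⊥ g (Hom⇒Operation∈⊥ Sig {A} 𝐀 Aᴶ δ δ∈𝔍 φ h) a)
        (Func.cong fᴬ λ j → Func.cong H λ b → φ⁻¹∘φ b j))
    where
    module Aᴶ≅δ = Inverse Aᴶ≅δ
    H = Hom.map h

    φ : Func Aᴶ (El δ)
    φ = record { to = Aᴶ≅δ.to ; cong = Aᴶ≅δ.to-cong }

    φ⁻¹∘φ : ∀ b j → (Aᴶ≅δ.from (Aᴶ≅δ.to b) ⟨$⟩ j) A.≈ (b ⟨$⟩ j)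
    φ⁻¹∘φ = Aᴶ≅δ.strictlyInverseʳ

    g = Hom⇒Operation Sig {A} 𝐀 Aᴶ δ δ∈𝔍 φ H

    -- Column d is the element of A^J coded by d, and row j pulled back along φ is the projection
    -- π_j. Hence f on columns followed by g gives h(f), and g on rows followed by f gives f(h ∘
    -- u_J).
    a : Func (El J ×ₛ El δ) (El A)
    a = record
      { to   = λ (j , d) → Aᴶ≅δ.from d ⟨$⟩ j
      ; cong = λ {(j , d)} {(j′ , d′)} (j≈j′ , d≈d′) →
          A.trans (Func.cong (Aᴶ≅δ.from d) j≈j′) (Aᴶ≅δ.from-cong d≈d′ j′)
      }

  -- For the homomorphism built from g and the columns of a, h(f) is g applied to the values of f on
  -- the columns, and h(π_j) is g applied to row j.
  commutesWithHoms⇒∈⊥⊥ : CommutesWithHoms → f ∈ (basics Sig {A} 𝐀 ^⊥) ^⊥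
  commutesWithHoms⇒∈⊥⊥ f-comm g g∈⊥ a =
    A.trans (Func.cong (Operation.op g) λ k → Func.cong fᴬ λ j → A.refl)
      (A.trans (f-comm (Operation⇒Hom Sig {A} 𝐀 Aᴶ g g∈⊥ (columns {𝔍 = 𝔍} {A} a)))
        (Func.cong fᴬ λ j → Func.cong (Operation.op g) λ k → A.refl))

theorem6p2 : ∀ {ℓ s} → (∀ {p} → ExcludedMiddle p) →
    (κ : V ℓ) → IsInaccessible κ →
    (α : V ℓ) → IsRegular α → IsStrongLimit α → α ≤ᵛ κ →
    (𝔍 : V ℓ) → (∀ J → J ∈ᵛ 𝔍 → IsαSmall κ α J) →
    (∀ J → IsCardinal J → IsαSmall κ α J → J ∈ᵛ 𝔍) →
    (Sig : Signature 𝔍 s) (A : V ℓ) (𝐀 : Algebra Sig (El A)) → IsαSmall κ α A →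
    (f : Operation 𝔍 A) →
    let J = Operation.arity f
        fᴬ = Operation.op f
        Aᴶ = El J ⇨ El A
    in f ∈ (basics Sig 𝐀 ^⊥) ^⊥ ⇔
       ((h : Hom Sig (power Sig 𝐀 Aᴶ) 𝐀) →
        Setoid._≈_ (El A) (Hom.map h ⟨$⟩ fᴬ)
                          (fᴬ ⟨$⟩ function (projections J A) (Hom.map h)))
theorem6p2 em κ κ-inacc α α-reg lim α≤κ 𝔍 𝔍⊆Small Card⊆𝔍 Sig A 𝐀 A-small f =
  let (δ , cδ , Aᴶ≅δ , δ∈α) = ∣∣<-⇨ α oα lim {El J} {El A}
        (proj₂ (𝔍⊆Small J (Operation.arity∈𝔍 f))) (proj₂ A-small)
      δ∈𝔍 = cardinal∈𝔍 κ α δ 𝔍 oκ α≤κ Card⊆𝔍 cδ δ∈α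
  in mk⇔ (∈⊥⊥⇒commutesWithHoms Sig {A} 𝐀 f δ δ∈𝔍 Aᴶ≅δ)
         (commutesWithHoms⇒∈⊥⊥ Sig {A} 𝐀 f)
  where
  open Classical em
  J  = Operation.arity f
  oα = IsCardinal.isOrdinal (IsRegular.isCardinal α-reg)
  oκ = IsCardinal.isOrdinal (IsRegular.isCardinal (IsInaccessible.isRegular κ-inacc))
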